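{- Let $G$ and $H$ be simple connected graphs, each with at least two vertices. Then the strong product $G \boxtimes H$ is isomorphic to the lexicographic product $G \circ H$ if and only if $H$ is a complete graph.
   Context: All graphs are finite, undirected and simple (no loops or multiple edges). For graphs $G$ and $H$, the following products have vertex set $V(G)\times V(H)$. The strong product $G\boxtimes H$: $(x,y)\sim(x',y')$ if either ($x\sim x'$ in $G$ and $y=y'$) or ($x=x'$ and $y\sim y'$ in $H$) or ($x\sim x'$ in $G$ and $y\sim y'$ in $H$). The lexicographic product $G\circ H$: $(x,y)\sim(x',y')$ if either $x\sim x'$ in $G$, or ($x=x'$ and $y\sim y'$ in $H$). Two graphs are isomorphic if there is a bijection between their vertex sets that preserves adjacency and non-adjacency. -}

module Defs where

open import Data.Fin using (Fin)
open import Data.Fin.Properties using (*↔×; inj⇒≟)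
open import Data.Nat using (ℕ; _*_)
open import Data.Product using (_×_; _,_)
open import Data.Product.Function.NonDependent.Propositional using (_×-↔_)
open import Data.Sum using (_⊎_; inj₁; inj₂)
open import Function.Bundles using (_↔_; _⤖_; module Bijection)
open import Function.Construct.Composition using (_↔-∘_)
open import Function.Construct.Symmetry using (↔-sym)
open import Function.Properties.Inverse using (↔⇒↣)
open import Relation.Binary.Construct.Closure.ReflexiveTransitive using (Star)
open import Relation.Binary.Definitions using (Decidable; DecidableEquality; Irreflexive; Symmetric)
open import Relation.Binary.PropositionalEquality using (_≡_; _≢_; refl; sym)
open import Relation.Nullary using (¬_)
open import Relation.Nullary.Decidable using (_×-dec_; _⊎-dec_)

-- Finite simple graphs.  Adjacency is decidable, as it is for any finite
-- graph classically, but it need not be proof-irrelevant: only its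
-- inhabitation matters.
record Graph : Set₁ where
  field
    Vertex     : Set
    order      : ℕ
    enumerate  : Vertex ↔ Fin order
    Adj        : Vertex → Vertex → Set
    adj?       : Decidable Adj
    adj-sym    : Symmetric Adj
    adj-irrefl : Irreflexive _≡_ Adj

  _≟_ : DecidableEquality Vertex
  _≟_ = inj⇒≟ (↔⇒↣ enumerate)

-- The empty graph is vacuously connected under this definition.
Connected : Graph → Set
Connected G = ∀ u v → Star (Graph.Adj G) u v

Complete : Graph → Set
Complete G = ∀ u v → u ≢ v → Graph.Adj G u v

infix 4 _≅_

record _≅_ (G H : Graph) : Set where
  private
    module G = Graph G
    module H = Graph H
  field
    bijection : G.Vertex ⤖ H.Vertex
  open Bijection bijection using (to)
  field
    preserves-adj    : ∀ u v → G.Adj u v → H.Adj (to u) (to v)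
    preserves-nonadj : ∀ u v → ¬ G.Adj u v → ¬ H.Adj (to u) (to v)

module _ (G H : Graph) where
  infixr 7 _⊠_ _∘_

  private
    module G = Graph G
    module H = Graph H

  StrongAdj : G.Vertex × H.Vertex → G.Vertex × H.Vertex → Set
  StrongAdj (x , y) (x′ , y′) =
    (G.Adj x x′ × y ≡ y′) ⊎ (x ≡ x′ × H.Adj y y′) ⊎ (G.Adj x x′ × H.Adj y y′)

  LexAdj : G.Vertex × H.Vertex → G.Vertex × H.Vertex → Set
  LexAdj (x , y) (x′ , y′) = G.Adj x x′ ⊎ (x ≡ x′ × H.Adj y y′)

  enumerate-× : (G.Vertex × H.Vertex) ↔ Fin (G.order * H.order)
  enumerate-× = ↔-sym *↔× ↔-∘ (G.enumerate ×-↔ H.enumerate)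

  -- Strong product.
  _⊠_ : Graph
  _⊠_ = record
    { Vertex     = G.Vertex × H.Vertex
    ; order      = G.order * H.order
    ; enumerate  = enumerate-×
    ; Adj        = StrongAdj
    ; adj?       = λ (x , y) (x′ , y′) →
        (G.adj? x x′ ×-dec y H.≟ y′)
          ⊎-dec (x G.≟ x′ ×-dec H.adj? y y′)
          ⊎-dec (G.adj? x x′ ×-dec H.adj? y y′)
    ; adj-sym    = λ
        { (inj₁ (p , q))        → inj₁ (G.adj-sym p , sym q)
        ; (inj₂ (inj₁ (p , q))) → inj₂ (inj₁ (sym p , H.adj-sym q))
        ; (inj₂ (inj₂ (p , q))) → inj₂ (inj₂ (G.adj-sym p , H.adj-sym q))
        }
    ; adj-irrefl = λ
        { refl (inj₁ (p , _))        → G.adj-irrefl refl p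
        ; refl (inj₂ (inj₁ (_ , q))) → H.adj-irrefl refl q
        ; refl (inj₂ (inj₂ (p , _))) → G.adj-irrefl refl p
        }
    }

  -- Lexicographic product (not function composition).
  _∘_ : Graph
  _∘_ = record
    { Vertex     = G.Vertex × H.Vertex
    ; order      = G.order * H.order
    ; enumerate  = enumerate-×
    ; Adj        = LexAdj
    ; adj?       = λ (x , y) (x′ , y′) →
        G.adj? x x′ ⊎-dec (x G.≟ x′ ×-dec H.adj? y y′)
    ; adj-sym    = λ
        { (inj₁ p)       → inj₁ (G.adj-sym p)
        ; (inj₂ (p , q)) → inj₂ (sym p , H.adj-sym q)
        }
    ; adj-irrefl = λ
        { refl (inj₁ p)       → G.adj-irrefl refl p
        ; refl (inj₂ (_ , q)) → H.adj-irrefl refl q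
        }
    }

{-# OPTIONS --safe #-}
-- Every edge of G ⊠ H is an edge of G ∘ H.  By finiteness, an isomorphism
-- then forces the two edge sets to coincide: the inverse isomorphism g acts
-- as an injection on pairs of vertices that sends lexicographic edges into
-- strong edges, and iterating it returns each lexicographic edge to itself.
-- Given an edge x ∼ x′ of G and y ≢ y′ in H, the lexicographic edge
-- (x , y) ∼ (x′ , y′) is therefore a strong edge, which forces y ∼ y′.
module Submission where

open import Defs
open import Data.Empty using (⊥-elim)
open import Data.Fin using (Fin; toℕ; zero; suc)
open import Data.Fin.Properties using (pigeonhole)
open import Data.Nat using (zero; suc; _≤_; _<_; z≤n; s≤s)
open import Data.Nat.GeneralisedArithmetic using (fold)
open import Data.Nat.Properties using (n<1+n)
open import Data.Product using (_,_; ∃; ∃₂; proj₁; proj₂)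
open import Data.Product.Properties using (×-≡,≡→≡)
open import Data.Sum using (inj₁; inj₂)
open import Function.Bundles using (_⇔_; _↣_; mk⇔; module Injection; module Inverse)
open import Function.Construct.Identity using (⤖-id)
open import Function.Definitions using (Injective)
open import Function.Properties.Bijection using (⤖⇒↔)
open import Function.Properties.Inverse using (↔⇒↣; ↔-sym)
open import Level using (0ℓ)
open import Relation.Binary.Construct.Closure.ReflexiveTransitive using (Star; ε; _◅_)
open import Relation.Binary.PropositionalEquality using (_≡_; _≢_; refl; sym; cong; subst; subst₂)
open import Relation.Nullary using (yes; no)
open import Relation.Nullary.Decidable using (decidable-stable)
open import Relation.Unary using (Pred; _⊆_)

module _ {A : Set} {f : A → A} (f-injective : Injective _≡_ _≡_ f) where

  -- Injectivity strips one `f` from both sides until the left one is `a`. Since `i < j`, at least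
  -- one application remains on the right.
  fold-cancel : ∀ {a} i j → i < j → fold a f i ≡ fold a f j →
    ∃ λ k → a ≡ fold a f (suc k)
  fold-cancel zero    (suc j) _         eq = j , eq
  fold-cancel (suc i) (suc j) (s≤s i<j) eq = fold-cancel i j i<j (f-injective eq)

  periodic : ∀ {n} → A ↣ Fin n → ∀ a → ∃ λ k → a ≡ fold a f (suc k)
  periodic {n} A↣Fin a
    with i , j , i<j , eq ← pigeonhole (n<1+n n) (λ i → Injection.to A↣Fin (fold a f (toℕ i)))
    = fold-cancel (toℕ i) (toℕ j) i<j (Injection.injective A↣Fin eq)

  -- The orbit of a point of `Q` stays in `Q`, and each application of `f` lands in `P`. Periodicity
  -- writes the point as an iterate with at least one application, so it lies in `P` itself.
  ⊆-reverse : ∀ {n} → A ↣ Fin n → {P Q : Pred A 0ℓ} → P ⊆ Q →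
    (∀ {a} → Q a → P (f a)) → Q ⊆ P
  ⊆-reverse A↣Fin {P} {Q} P⊆Q Q⇒Pf {a} q with k , a≡ ← periodic A↣Fin a =
    subst P (sym a≡) (Q⇒Pf (Q-fold k))
    where
    Q-fold : ∀ k → Q (fold a f k)
    Q-fold zero    = q
    Q-fold (suc k) = P⊆Q (Q⇒Pf (Q-fold k))

distinct : ∀ {n} → 2 ≤ n → ∃₂ λ (i j : Fin n) → i ≢ j
distinct (s≤s (s≤s z≤n)) = zero , suc zero , λ ()

first-edge : (G : Graph) → ∀ {u v} → u ≢ v → Star (Graph.Adj G) u v → ∃₂ (Graph.Adj G)
first-edge G u≢v ε       = ⊥-elim (u≢v refl)
first-edge G u≢v (e ◅ _) = _ , _ , e

has-edge : (G : Graph) → Connected G → 2 ≤ Graph.order G → ∃₂ (Graph.Adj G)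
has-edge G conn 2≤n with i , j , i≢j ← distinct 2≤n =
  first-edge G (λ eq → i≢j (Injection.injective (↔⇒↣ (↔-sym enumerate)) eq)) (conn (from i) (from j))
  where
  open Graph G using (enumerate)
  open Inverse enumerate using (from)

from-adj : ∀ {K L} (K≅L : K ≅ L) → let open Inverse (⤖⇒↔ (_≅_.bijection K≅L)) using (from) in
  ∀ {u v} → Graph.Adj L u v → Graph.Adj K (from u) (from v)
-- Preservation of non-adjacency only refutes `¬e`; decidability of adjacency in `K` turns this into
-- an edge.
from-adj {K} {L} K≅L {u} {v} e = decidable-stable (Graph.adj? K (from u) (from v)) λ ¬e →
  preserves-nonadj _ _ ¬e
    (subst₂ (Graph.Adj L) (sym (strictlyInverseˡ u)) (sym (strictlyInverseˡ v)) e)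
  where
  open _≅_ K≅L
  open Inverse (⤖⇒↔ bijection) using (from; strictlyInverseˡ)

module _ (G H : Graph) where

  strong⇒lex : ∀ {u v} → StrongAdj G H u v → LexAdj G H u v
  strong⇒lex (inj₁ (p , _))        = inj₁ p
  strong⇒lex (inj₂ (inj₁ q))       = inj₂ q
  strong⇒lex (inj₂ (inj₂ (p , _))) = inj₁ p

  lex⇒strong : G ⊠ H ≅ G ∘ H → ∀ {u v} → LexAdj G H u v → StrongAdj G H u v
  lex⇒strong iso = ⊆-reverse
    -- The self-map applies the inverse isomorphism to both endpoints, so it is injective
    -- coordinatewise.
    (λ eq → ×-≡,≡→≡ (from-injective (cong proj₁ eq) , from-injective (cong proj₂ eq)))
    -- Both products have the same vertex set, so this enumerates the pairs of vertices of either
    -- one.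
    (↔⇒↣ (enumerate-× (G ⊠ H) (G ⊠ H)))
    {P = λ (u , v) → StrongAdj G H u v} {Q = λ (u , v) → LexAdj G H u v}
    strong⇒lex (from-adj iso)
    where
    V↔V = ⤖⇒↔ (_≅_.bijection iso)
    from-injective : Injective _≡_ _≡_ (Inverse.from V↔V)
    from-injective = Injection.injective (↔⇒↣ (↔-sym V↔V))

  strong⇒adj₂ : ∀ {x x′ y y′} → y ≢ y′ → StrongAdj G H (x , y) (x′ , y′) → Graph.Adj H y y′
  strong⇒adj₂ y≢y′ (inj₁ (_ , y≡y′))        = ⊥-elim (y≢y′ y≡y′)
  strong⇒adj₂ y≢y′ (inj₂ (inj₁ (_ , y∼y′))) = y∼y′
  strong⇒adj₂ y≢y′ (inj₂ (inj₂ (_ , y∼y′))) = y∼y′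

  ≅⇒complete : ∃₂ (Graph.Adj G) → G ⊠ H ≅ G ∘ H → Complete H
  ≅⇒complete (x , x′ , x∼x′) iso y y′ y≢y′ = strong⇒adj₂ y≢y′ (lex⇒strong iso (inj₁ x∼x′))

  complete⇒lex⇒strong : Complete H → ∀ {u v} → LexAdj G H u v → StrongAdj G H u v
  complete⇒lex⇒strong complete (inj₂ q) = inj₂ (inj₁ q)
  complete⇒lex⇒strong complete {_ , y} {_ , y′} (inj₁ p) with Graph._≟_ H y y′
  ... | yes y≡y′ = inj₁ (p , y≡y′)
  ... | no  y≢y′ = inj₂ (inj₂ (p , complete y y′ y≢y′))

  -- Over an edge of `G`, any two second coordinates are equal or, by completeness, adjacent. The
  -- edge sets therefore agree and the identity suffices.
  complete⇒≅ : Complete H → G ⊠ H ≅ G ∘ H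
  complete⇒≅ complete = record
    { bijection        = ⤖-id _
    ; preserves-adj    = λ _ _ → strong⇒lex
    ; preserves-nonadj = λ _ _ ¬strong lex → ¬strong (complete⇒lex⇒strong complete lex)
    }

theorem3p8 : (G H : Graph) → Connected G → Connected H →
    2 ≤ Graph.order G → 2 ≤ Graph.order H →
    (G ⊠ H ≅ G ∘ H) ⇔ Complete H
theorem3p8 G H G-connected _ 2≤∣G∣ _ =
  mk⇔ (≅⇒complete G H (has-edge G G-connected 2≤∣G∣)) (complete⇒≅ G H)
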